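{- For every (non-degenerate) triangle in the Euclidean plane with circumradius $R$, and for the radius $r$ of any one of its three excircles, one has $R/r > 1/4$.
   Context: An excircle of a triangle is a circle outside the triangle that is tangent to one side and to the extensions of the other two sides. If the side lengths are $f,g,h$, $s=(f+g+h)/2$, and $r$ is the radius of the excircle touching the side $h$ from outside, then $R=\frac{fgh}{4\Delta}$ and $r=\sqrt{\frac{s(s-f)(s-g)}{s-h}}$, where $\Delta=\sqrt{s(s-f)(s-g)(s-h)}$ is the area. -}

module Defs where

open import Level using (Level; _⊔_; suc)
open import Algebra.Apartness.Bundles using (HeytingField; HeytingCommutativeRing)
open import Algebra.Bundles using (CommutativeRing)
import Algebra.Definitions.RawMonoid as RawMonoidDefinitions
import Algebra.Properties.Ring as RingProperties
open import Data.Nat.Base as ℕ using (ℕ)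
open import Data.Product.Base using (_×_; _,_; proj₁; ∃-syntax)
open import Data.Product.Relation.Binary.Pointwise.NonDependent using (Pointwise)
open import Data.Sum.Base using (_⊎_; inj₁; inj₂)
open import Data.Empty using (⊥-elim)
open import Function.Base using (_∘_)
open import Function.Bundles using (_⇔_; module Equivalence)
open import Relation.Binary.Core using (Rel)
open import Relation.Binary.Structures using (IsStrictPartialOrder)
open import Relation.Nullary.Negation using (¬_)

-- The real numbers, axiomatised as a Cauchy-complete Archimedean ordered
-- field.  No decidability is assumed: the field is a Heyting field whose
-- apartness is the one induced by the strict order (so cotransitivity of _<_
-- and tightness follow from the corresponding properties of _#_).  With
-- excluded middle these axioms determine ℝ up to isomorphism.

record Reals (c ℓ₁ ℓ₂ : Level) : Set (suc (c ⊔ ℓ₁ ⊔ ℓ₂)) where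
  infix 4 _<_ _≤_
  field
    heytingField : HeytingField c ℓ₁ ℓ₂

  open HeytingField heytingField public
  open HeytingCommutativeRing heytingCommutativeRing public
    using (commutativeRing)
  open CommutativeRing commutativeRing public
    using (ring; +-rawMonoid)

  field
    _<_                  : Rel Carrier ℓ₂
    isStrictPartialOrder : IsStrictPartialOrder _≈_ _<_
    #⇔<⊎>                : ∀ {x y} → x # y ⇔ (x < y ⊎ y < x)
    +-monoˡ-<            : ∀ z {x y} → x < y → x + z < y + z
    *-pos                : ∀ {x y} → 0# < x → 0# < y → 0# < x * y

  open IsStrictPartialOrder isStrictPartialOrder public
    using (<-resp-≈; <-respˡ-≈; <-respʳ-≈)
    renaming (irrefl to <-irrefl; trans to <-trans; asym to <-asym)

  open RawMonoidDefinitions +-rawMonoid public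
    using () renaming (_×_ to _·_)

  _≤_ : Rel Carrier ℓ₂
  x ≤ y = ¬ (y < x)

  -- |x - y| < 1 / (k + 1)
  Close : ℕ → Rel Carrier ℓ₂
  Close k x y = (ℕ.suc k · (x - y) < 1#) × (ℕ.suc k · (y - x) < 1#)

  IsCauchy : (ℕ → Carrier) → Set ℓ₂
  IsCauchy s = ∀ k → ∃[ N ] (∀ m n → N ℕ.≤ m → N ℕ.≤ n → Close k (s m) (s n))

  _ConvergesTo_ : (ℕ → Carrier) → Carrier → Set ℓ₂
  s ConvergesTo x = ∀ k → ∃[ N ] (∀ n → N ℕ.≤ n → Close k (s n) x)

  field
    archimedean : ∀ x → ∃[ n ] x < n · 1#
    complete    : ∀ s → IsCauchy s → ∃[ x ] s ConvergesTo x

module Positivity {c ℓ₁ ℓ₂} (ℝ : Reals c ℓ₁ ℓ₂) where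
  open Reals ℝ
  open RingProperties ring using (-‿distribˡ-*; -‿distribʳ-*; -‿involutive; -0#≈0#)

  pos⇒#0 : ∀ {x} → 0# < x → x # 0#
  pos⇒#0 = Equivalence.from #⇔<⊎> ∘ inj₂

  1#0 : 1# # 0#
  1#0 = invertible⇒# (1# , trans (*-identityˡ _) 1-0≈1 , trans (*-identityʳ _) 1-0≈1)
    where
    1-0≈1 : 1# - 0# ≈ 1#
    1-0≈1 = trans (+-congˡ -0#≈0#) (+-identityʳ 1#)

  0<1 : 0# < 1#
  0<1 with Equivalence.to #⇔<⊎> 1#0
  ... | inj₂ 0<1′ = 0<1′
  ... | inj₁ 1<0  = ⊥-elim (<-asym 1<0 (<-respʳ-≈ [-1]²≈1 (*-pos 0<-1 0<-1)))
    where
    0<-1 : 0# < - 1#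
    0<-1 = <-respˡ-≈ (-‿inverseʳ 1#) (<-respʳ-≈ (+-identityˡ (- 1#)) (+-monoˡ-< (- 1#) 1<0))

    [-1]²≈1 : - 1# * - 1# ≈ 1#
    [-1]²≈1 = trans (sym (-‿distribˡ-* 1# (- 1#)))
             (trans (-‿cong (*-identityˡ (- 1#))) (-‿involutive 1#))

  0<suc : ∀ n → 0# < ℕ.suc n · 1#
  0<suc ℕ.zero    = <-respʳ-≈ (sym (+-identityʳ 1#)) 0<1
  0<suc (ℕ.suc n) = <-trans (0<suc n)
    (<-respˡ-≈ (+-identityˡ _) (+-monoˡ-< (ℕ.suc n · 1#) 0<1))

module EuclideanPlane {c ℓ₁ ℓ₂} (ℝ : Reals c ℓ₁ ℓ₂) where
  open Reals ℝ
  open Positivity ℝ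

  infix  4 _≈ᵖ_ _,⁺_
  infixl 7 _/_

  record ℝ⁺ : Set (c ⊔ ℓ₂) where
    constructor _,⁺_
    field
      value    : Carrier
      positive : 0# < value

  open ℝ⁺ public

  _/_ : Carrier → ℝ⁺ → Carrier
  x / (y ,⁺ 0<y) = x * proj₁ (#⇒invertible (pos⇒#0 0<y))

  1/4 : Carrier
  1/4 = 1# / (4 · 1# ,⁺ 0<suc 3)

  Point : Set c
  Point = Carrier × Carrier

  _≈ᵖ_ : Rel Point ℓ₁
  _≈ᵖ_ = Pointwise _≈_ _≈_

  dist² : Point → Point → Carrier
  dist² (x₁ , y₁) (x₂ , y₂) = (x₁ - x₂) * (x₁ - x₂) + (y₁ - y₂) * (y₁ - y₂)

  OnCircle : Point → ℝ⁺ → Point → Set ℓ₁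
  OnCircle O r P = dist² O P ≈ value r * value r

  -- P + t (Q - P)
  along : Point → Point → Carrier → Point
  along (x₁ , y₁) (x₂ , y₂) t = (x₁ + t * (x₂ - x₁)) , (y₁ + t * (y₂ - y₁))

  OnLine : Point → Point → Point → Set (c ⊔ ℓ₁)
  OnLine P Q X = ∃[ t ] X ≈ᵖ along P Q t

  OnSegment : Point → Point → Point → Set (c ⊔ ℓ₁ ⊔ ℓ₂)
  OnSegment P Q X = ∃[ t ] (0# ≤ t × t ≤ 1# × X ≈ᵖ along P Q t)

  -- On the line PQ, beyond either endpoint of the segment PQ.
  OnExtension : Point → Point → Point → Set (c ⊔ ℓ₁ ⊔ ℓ₂)
  OnExtension P Q X = ∃[ t ] ((t < 0# ⊎ 1# < t) × X ≈ᵖ along P Q t)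

  -- The line PQ meets the circle with centre O and radius r in X only.
  record TangentAt (O : Point) (r : ℝ⁺) (P Q X : Point) : Set (c ⊔ ℓ₁) where
    field
      onCircle : OnCircle O r X
      onLine   : OnLine P Q X
      unique   : ∀ Y → OnCircle O r Y → OnLine P Q Y → Y ≈ᵖ X

  -- Twice the signed area of the triangle PQS.
  det : Point → Point → Point → Carrier
  det (x₁ , y₁) (x₂ , y₂) (x₃ , y₃) =
    (x₂ - x₁) * (y₃ - y₁) - (y₂ - y₁) * (x₃ - x₁)

  record Triangle : Set (c ⊔ ℓ₂) where
    field
      A B C         : Point
      nondegenerate : det A B C # 0#

  -- Barycentric coordinates that are all positive.
  Interior : Point → Point → Point → Point → Set (c ⊔ ℓ₁ ⊔ ℓ₂)
  Interior (x₁ , y₁) (x₂ , y₂) (x₃ , y₃) P =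
    ∃[ u ] ∃[ v ] ∃[ w ]
      ( 0# < u × 0# < v × 0# < w × u + v + w ≈ 1#
      × P ≈ᵖ ( u * x₁ + v * x₂ + w * x₃ , u * y₁ + v * y₂ + w * y₃ ))

  -- The excircle of the triangle ABC that touches the side BC.
  record IsExcircleOpposite (A B C O : Point) (r : ℝ⁺) : Set (c ⊔ ℓ₁ ⊔ ℓ₂) where
    field
      outside    : ∀ P → OnCircle O r P → ¬ Interior A B C P
      touches-BC : ∃[ X ] (OnSegment   B C X × TangentAt O r B C X)
      touches-AB : ∃[ X ] (OnExtension A B X × TangentAt O r A B X)
      touches-AC : ∃[ X ] (OnExtension A C X × TangentAt O r A C X)

  IsCircumradius : Triangle → ℝ⁺ → Set (c ⊔ ℓ₁)
  IsCircumradius T R = ∃[ O ] (OnCircle O R A × OnCircle O R B × OnCircle O R C)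
    where open Triangle T

  IsExradius : Triangle → ℝ⁺ → Set (c ⊔ ℓ₁ ⊔ ℓ₂)
  IsExradius T r = ∃[ O ]
    ( IsExcircleOpposite A B C O r
    ⊎ IsExcircleOpposite B C A O r
    ⊎ IsExcircleOpposite C A B O r )
    where open Triangle T

-- Put the centre of the excircle at 0, let N₁, N₂, N₃ be its points of contact
-- with BC, CA, AB, and ρ = r².  The cross products p = N₃ ∧ B = − N₁ ∧ B,
-- q = N₁ ∧ C = − N₂ ∧ C, t = N₂ ∧ A = − N₃ ∧ A are r times the signed tangent
-- lengths, so ρ |BC|² = (p + q)² etc. and the doubled area is D = 2 (p + q + t).
-- Heron's formula becomes p q t = ρ² (p + q + t), and then 4 R² D² = |BC|² |CA|² |AB|²
-- becomes 16 R² ρ⁵ = (ρ² + p²)(ρ² + q²)(ρ² + t²) > ρ⁶.  Working with squared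
-- distances avoids square roots, and no case distinction between the
-- incircle and the three excircles is needed.
module Submission where

open import Defs
open import Algebra.Bundles using (CommutativeRing)
import Algebra.Apartness.Properties.HeytingCommutativeRing as HeytingProperties
import Algebra.Properties.Ring as RingProperties
import Algebra.Properties.Semiring.Mult as SemiringMult
import Algebra.Solver.Ring as RingSolver
open import Algebra.Solver.Ring.AlmostCommutativeRing
  using (fromCommutativeRing; _-Raw-AlmostCommutative⟶_)
open import Data.Integer.Base as ℤ using (ℤ; +_; -[1+_])
import Data.Integer.Properties as ℤ
open import Data.Maybe.Base using (Maybe; map)
open import Data.Nat.Base as ℕ using (ℕ)
import Data.Nat.Properties as ℕ
open import Data.Product.Base using (_×_; _,_; proj₁; proj₂; ∃-syntax)
import Data.Sign.Base as Sign
open import Data.Sum.Base using (_⊎_; inj₁; inj₂; [_,_]′)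
open import Function.Base using (id)
open import Function.Bundles using (module Equivalence)
import Relation.Binary.PropositionalEquality.Core as ≡
import Relation.Binary.Reasoning.Setoid as SetoidReasoning
open import Relation.Nullary.Decidable using (dec⇒maybe)
open import Relation.Nullary.Negation using (contradiction)

-- Ring solver with integer coefficients

module IntegerCoefficients {c ℓ} (R : CommutativeRing c ℓ) where
  open CommutativeRing R
  open RingProperties ring
  open SemiringMult semiring using (×-homo-+; ×1-homo-*) renaming (_×_ to _·_)
  open SetoidReasoning setoid

  -- Nonnegative coefficients go to multiples of `1#` definitionally, so `con (+ 4)` in a solver
  -- equation matches `4 · 1#` in a statement.
  fromℤ : ℤ → Carrier
  fromℤ (+ n)    = n · 1#
  fromℤ -[1+ n ] = - (ℕ.suc n · 1#)

  fromℤ-⊖ : ∀ m n → fromℤ (m ℤ.⊖ n) ≈ m · 1# - n · 1#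
  fromℤ-⊖ m         ℕ.zero    = sym (trans (+-congˡ -0#≈0#) (+-identityʳ _))
  fromℤ-⊖ ℕ.zero    (ℕ.suc n) = sym (+-identityˡ _)
  fromℤ-⊖ (ℕ.suc m) (ℕ.suc n) = begin
    fromℤ (ℕ.suc m ℤ.⊖ ℕ.suc n)           ≡⟨ ≡.cong fromℤ (ℤ.[1+m]⊖[1+n]≡m⊖n m n) ⟩
    fromℤ (m ℤ.⊖ n)                       ≈⟨ fromℤ-⊖ m n ⟩
    m · 1# - n · 1#                       ≈⟨ +-congʳ (+-identityˡ _) ⟨
    0# + m · 1# - n · 1#                  ≈⟨ +-congʳ (+-congʳ (-‿inverseʳ 1#)) ⟨
    1# - 1# + m · 1# - n · 1#             ≈⟨ +-congʳ (+-assoc _ _ _) ⟩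
    1# + (- 1# + m · 1#) - n · 1#         ≈⟨ +-congʳ (+-congˡ (+-comm _ _)) ⟩
    1# + (m · 1# - 1#) - n · 1#           ≈⟨ +-congʳ (+-assoc _ _ _) ⟨
    1# + m · 1# - 1# - n · 1#             ≈⟨ +-assoc _ _ _ ⟩
    (1# + m · 1#) + (- 1# - n · 1#)       ≈⟨ +-congˡ (-‿+-comm _ _) ⟩
    (1# + m · 1#) - (1# + n · 1#)         ∎

  fromℤ-+ : ∀ i j → fromℤ (i ℤ.+ j) ≈ fromℤ i + fromℤ j
  fromℤ-+ (+ m)    (+ n)    = ×-homo-+ 1# m n
  fromℤ-+ (+ m)    -[1+ n ] = fromℤ-⊖ m (ℕ.suc n)
  fromℤ-+ -[1+ m ] (+ n)    = trans (fromℤ-⊖ n (ℕ.suc m)) (+-comm _ _)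
  fromℤ-+ -[1+ m ] -[1+ n ] = begin
    - (ℕ.suc (ℕ.suc (m ℕ.+ n)) · 1#)       ≡⟨ ≡.cong (λ k → - (ℕ.suc k · 1#)) (ℕ.+-suc m n) ⟨
    - ((ℕ.suc m ℕ.+ ℕ.suc n) · 1#)         ≈⟨ -‿cong (×-homo-+ 1# (ℕ.suc m) (ℕ.suc n)) ⟩
    - (ℕ.suc m · 1# + ℕ.suc n · 1#)        ≈⟨ -‿+-comm _ _ ⟨
    - (ℕ.suc m · 1#) - ℕ.suc n · 1#        ∎

  -- Integer multiplication is defined through `◃`, which separates zero from the successors; this
  -- and its negative twin remove that split.
  fromℤ-+◃ : ∀ n → fromℤ (Sign.+ ℤ.◃ n) ≈ n · 1#
  fromℤ-+◃ ℕ.zero    = refl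
  fromℤ-+◃ (ℕ.suc n) = refl

  fromℤ--◃ : ∀ n → fromℤ (Sign.- ℤ.◃ n) ≈ - (n · 1#)
  fromℤ--◃ ℕ.zero    = sym -0#≈0#
  fromℤ--◃ (ℕ.suc n) = refl

  fromℤ-* : ∀ i j → fromℤ (i ℤ.* j) ≈ fromℤ i * fromℤ j
  fromℤ-* (+ m) (+ n) = trans (fromℤ-+◃ (m ℕ.* n)) (×1-homo-* m n)
  fromℤ-* (+ m) -[1+ n ] = begin
    fromℤ (Sign.- ℤ.◃ m ℕ.* ℕ.suc n)  ≈⟨ fromℤ--◃ (m ℕ.* ℕ.suc n) ⟩
    - ((m ℕ.* ℕ.suc n) · 1#)          ≈⟨ -‿cong (×1-homo-* m (ℕ.suc n)) ⟩
    - (m · 1# * ℕ.suc n · 1#)         ≈⟨ -‿distribʳ-* _ _ ⟩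
    m · 1# * - (ℕ.suc n · 1#)         ∎
  fromℤ-* -[1+ m ] (+ n) = begin
    fromℤ (Sign.- ℤ.◃ ℕ.suc m ℕ.* n)  ≈⟨ fromℤ--◃ (ℕ.suc m ℕ.* n) ⟩
    - ((ℕ.suc m ℕ.* n) · 1#)          ≈⟨ -‿cong (×1-homo-* (ℕ.suc m) n) ⟩
    - (ℕ.suc m · 1# * n · 1#)         ≈⟨ -‿distribˡ-* _ _ ⟩
    - (ℕ.suc m · 1#) * n · 1#         ∎
  fromℤ-* -[1+ m ] -[1+ n ] = begin
    (ℕ.suc m ℕ.* ℕ.suc n) · 1#            ≈⟨ ×1-homo-* (ℕ.suc m) (ℕ.suc n) ⟩
    ℕ.suc m · 1# * ℕ.suc n · 1#           ≈⟨ -‿involutive _ ⟨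
    - - (ℕ.suc m · 1# * ℕ.suc n · 1#)     ≈⟨ -‿cong (-‿distribˡ-* _ _) ⟩
    - (- (ℕ.suc m · 1#) * ℕ.suc n · 1#)   ≈⟨ -‿distribʳ-* _ _ ⟩
    - (ℕ.suc m · 1#) * - (ℕ.suc n · 1#)   ∎

  fromℤ-neg : ∀ i → fromℤ (ℤ.- i) ≈ - fromℤ i
  fromℤ-neg (+ ℕ.zero)    = sym -0#≈0#
  fromℤ-neg (+ (ℕ.suc n)) = refl
  fromℤ-neg -[1+ n ]      = sym (-‿involutive _)

  morphism : ℤ.+-*-rawRing -Raw-AlmostCommutative⟶ fromCommutativeRing R
  morphism = record
    { ⟦_⟧    = fromℤ
    ; +-homo = fromℤ-+
    ; *-homo = fromℤ-*
    ; -‿homo = fromℤ-neg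
    ; 0-homo = refl
    ; 1-homo = +-identityʳ 1#
    }

  -- Testing the integers themselves lets the solver drop cancelled coefficients although `_≈_` is
  -- not assumed decidable.
  fromℤ≟ : ∀ i j → Maybe (fromℤ i ≈ fromℤ j)
  fromℤ≟ i j = map (λ { ≡.refl → refl }) (dec⇒maybe (i ℤ.≟ j))

  open RingSolver ℤ.+-*-rawRing (fromCommutativeRing R) morphism fromℤ≟ public
    using (Polynomial; con; solve; _:+_; _:*_; _:-_; :-_; _:=_)

-- Inverses, signs and squares in a constructive ordered field

module OrderedField {c ℓ₁ ℓ₂} (ℝ : Reals c ℓ₁ ℓ₂) where
  open Reals ℝ
  open Positivity ℝ
  open IntegerCoefficients commutativeRing
  open HeytingProperties heytingCommutativeRing using (#-congʳ)
  open SetoidReasoning setoid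

  infixl 6 _⊕_
  infixr 7 _⊛_

  #⇒inverse : ∀ {x} → x # 0# → ∃[ i ] i * x ≈ 1#
  #⇒inverse {x} x#0 with i , ix≈1 , _ ← #⇒invertible x#0 =
    i , trans (solve 2 (λ i x → i :* x := i :* (x :- con (+ 0))) refl i x) ix≈1

  inverse⇒# : ∀ {i x} → i * x ≈ 1# → x # 0#
  inverse⇒# {i} {x} ix≈1 = invertible⇒# (i , left , trans (*-comm _ _) left)
    where
    left : i * (x - 0#) ≈ 1#
    left = trans (solve 2 (λ i x → i :* (x :- con (+ 0)) := i :* x) refl i x) ix≈1

  -- If `i` inverts `x * y`, then `i * x` inverts `y`.
  *-#0ʳ : ∀ {x y} → x * y # 0# → y # 0#
  *-#0ʳ {x} xy#0 = let i , ixy≈1 = #⇒inverse xy#0 in inverse⇒# (trans (*-assoc i x _) ixy≈1)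

  *-#0ˡ : ∀ {x y} → x * y # 0# → x # 0#
  *-#0ˡ xy#0 = *-#0ʳ (#-congʳ (*-comm _ _) xy#0)

  *-cancel-0 : ∀ {x y} → x # 0# → x * y ≈ 0# → y ≈ 0#
  *-cancel-0 {x} {y} x#0 xy≈0 = let i , ix≈1 = #⇒inverse x#0 in begin
    y            ≈⟨ *-identityˡ y ⟨
    1# * y       ≈⟨ *-congʳ ix≈1 ⟨
    i * x * y    ≈⟨ *-assoc i x y ⟩
    i * (x * y)  ≈⟨ *-congˡ xy≈0 ⟩
    i * 0#       ≈⟨ zeroʳ i ⟩
    0#           ∎

  x≈y⇒x-y≈0 : ∀ {x y} → x ≈ y → x - y ≈ 0#
  x≈y⇒x-y≈0 {_} {y} x≈y = trans (+-congʳ x≈y) (-‿inverseʳ y)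

  x-y≈0⇒x≈y : ∀ {x y} → x - y ≈ 0# → x ≈ y
  x-y≈0⇒x≈y {x} {y} x-y≈0 = begin
    x          ≈⟨ solve 2 (λ x y → x := x :- y :+ y) refl x y ⟩
    x - y + y  ≈⟨ +-congʳ x-y≈0 ⟩
    0# + y     ≈⟨ +-identityˡ y ⟩
    y          ∎

  _⊕_ : ∀ {x y} → x ≈ 0# → y ≈ 0# → x + y ≈ 0#
  x≈0 ⊕ y≈0 = trans (+-cong x≈0 y≈0) (+-identityʳ 0#)

  _⊛_ : ∀ k {x y} → x ≈ y → k * (x - y) ≈ 0#
  k ⊛ x≈y = trans (*-congˡ (x≈y⇒x-y≈0 x≈y)) (zeroʳ k)

  -- x ≈ y follows from equations aᵢ ≈ bᵢ once x - y is exhibited as a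
  -- combination Σ kᵢ * (aᵢ - bᵢ): linear identity (_ ⊛ e₁ ⊕ _ ⊛ e₂ ⊕ …).
  linear : ∀ {x y z} → x - y ≈ z → z ≈ 0# → x ≈ y
  linear x-y≈z z≈0 = x-y≈0⇒x≈y (trans x-y≈z z≈0)

  0<y-x⇒x<y : ∀ {x y} → 0# < y - x → x < y
  0<y-x⇒x<y {x} {y} 0<y-x =
    <-respˡ-≈ (+-identityˡ x)
      (<-respʳ-≈ (solve 2 (λ x y → y :- x :+ x := y) refl x y) (+-monoˡ-< x 0<y-x))

  x<y⇒0<y-x : ∀ {x y} → x < y → 0# < y - x
  x<y⇒0<y-x {x} x<y = <-respˡ-≈ (-‿inverseʳ x) (+-monoˡ-< (- x) x<y)

  x<0⇒0<-x : ∀ {x} → x < 0# → 0# < - x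
  x<0⇒0<-x {x} x<0 = <-respʳ-≈ (+-identityˡ (- x)) (x<y⇒0<y-x x<0)

  +-pos : ∀ {x y} → 0# < x → 0# < y → 0# < x + y
  +-pos {x} {y} 0<x 0<y = <-trans 0<y (<-respˡ-≈ (+-identityˡ y) (+-monoˡ-< y 0<x))

  -- Since `0# ≤ y` is a negation, it allows no case split on `y`. Cotransitivity compares `x + y`
  -- with both `x` and `0#` instead; every unwanted sign would force `y < 0#`.
  +-pos-nonneg : ∀ {x y} → 0# < x → 0# ≤ y → 0# < x + y
  +-pos-nonneg {x} {y} 0<x 0≤y with #-cotrans (pos⇒#0 0<x) (x + y)
  ... | inj₂ x+y#0 with Equivalence.to #⇔<⊎> x+y#0
  ...   | inj₂ 0<x+y = 0<x+y
  ...   | inj₁ x+y<0 = contradiction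
    (<-respʳ-≈ (+-identityˡ 0#)
      (<-trans (<-respˡ-≈ (+-identityˡ y) (+-monoˡ-< y 0<x)) (<-respʳ-≈ (sym (+-identityˡ 0#)) x+y<0)))
    0≤y
  +-pos-nonneg {x} {y} 0<x 0≤y | inj₁ x#x+y with Equivalence.to #⇔<⊎> x#x+y
  ... | inj₁ x<x+y = <-trans 0<x x<x+y
  ... | inj₂ x+y<x = contradiction y<0 0≤y
    where
    y<0 : y < 0#
    y<0 = <-respˡ-≈ (solve 2 (λ x y → x :+ y :- x := y) refl x y)
            (<-respʳ-≈ (-‿inverseʳ x) (+-monoˡ-< (- x) x+y<x))

  x#0⇒0<x² : ∀ {x} → x # 0# → 0# < x * x
  x#0⇒0<x² {x} x#0 with Equivalence.to #⇔<⊎> x#0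
  ... | inj₂ 0<x = *-pos 0<x 0<x
  ... | inj₁ x<0 = <-respʳ-≈ (solve 1 (λ x → :- x :* :- x := x :* x) refl x)
                     (*-pos (x<0⇒0<-x x<0) (x<0⇒0<-x x<0))

  -- A negative square would be apart from zero, hence so would `x`, and then the square is
  -- positive.
  0≤x² : ∀ x → 0# ≤ x * x
  0≤x² x x²<0 = <-asym x²<0 (x#0⇒0<x² (*-#0ˡ (Equivalence.from #⇔<⊎> (inj₁ x²<0))))

  -- The product is apart from zero, so `x` has a sign; a negative `x` would make `x * y + - x * y`
  -- positive.
  *-cancelʳ-pos : ∀ {x y} → 0# < y → 0# < x * y → 0# < x
  *-cancelʳ-pos {x} {y} 0<y 0<xy =
    [ (λ x<0 → contradiction (0<0 x<0) (<-irrefl refl)) , id ]′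
      (Equivalence.to #⇔<⊎> (*-#0ˡ (pos⇒#0 0<xy)))
    where
    0<0 : x < 0# → 0# < 0#
    0<0 x<0 = <-respʳ-≈ (solve 2 (λ x y → x :* y :+ :- x :* y := con (+ 0)) refl x y)
                (+-pos 0<xy (*-pos (x<0⇒0<-x x<0) 0<y))

-- Dot and cross products in the plane

module Plane {c ℓ₁ ℓ₂} (ℝ : Reals c ℓ₁ ℓ₂) where
  open Reals ℝ
  open Positivity ℝ
  open EuclideanPlane ℝ
  open OrderedField ℝ
  open IntegerCoefficients commutativeRing
  open HeytingProperties heytingCommutativeRing using (x#0y#0→xy#0; #-congʳ)
  open SetoidReasoning setoid

  infixl 6 _⊖_ _⊖ₚ_
  infix  8 _∙_ _∧_
  infix  9 _∙ₚ_ _∧ₚ_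

  _⊖_ : Point → Point → Point
  (x₁ , y₁) ⊖ (x₂ , y₂) = x₁ - x₂ , y₁ - y₂

  _∙_ _∧_ : Point → Point → Carrier
  (x₁ , y₁) ∙ (x₂ , y₂) = x₁ * x₂ + y₁ * y₂
  (x₁ , y₁) ∧ (x₂ , y₂) = x₁ * y₂ - y₁ * x₂

  -- Mirrors points inside the solver, so that vector identities can be stated in vector notation.
  PolynomialPoint : ℕ → Set
  PolynomialPoint n = Polynomial n × Polynomial n

  _⊖ₚ_ : ∀ {n} → PolynomialPoint n → PolynomialPoint n → PolynomialPoint n
  (x₁ , y₁) ⊖ₚ (x₂ , y₂) = x₁ :- x₂ , y₁ :- y₂

  _∙ₚ_ _∧ₚ_ : ∀ {n} → PolynomialPoint n → PolynomialPoint n → Polynomial n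
  (x₁ , y₁) ∙ₚ (x₂ , y₂) = x₁ :* x₂ :+ y₁ :* y₂
  (x₁ , y₁) ∧ₚ (x₂ , y₂) = x₁ :* y₂ :- y₁ :* x₂

  rayₚ : ∀ {n} → PolynomialPoint n → PolynomialPoint n → Polynomial n → PolynomialPoint n
  rayₚ (x₁ , y₁) (x₂ , y₂) t = x₁ :+ t :* x₂ , y₁ :+ t :* y₂

  lagrange : ∀ u v → u ∙ u * v ∙ v ≈ u ∧ v * u ∧ v + u ∙ v * u ∙ v
  lagrange (a , b) (c , d) = solve 4 (λ a b c d → let u = a , b; v = c , d in
    u ∙ₚ u :* v ∙ₚ v := u ∧ₚ v :* u ∧ₚ v :+ u ∙ₚ v :* u ∙ₚ v) refl a b c d

  -- By Lagrange's identity the product of the squared norms is a positive square plus a nonnegative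
  -- one. It shows that the sides of a nondegenerate triangle have nonzero length.
  ∧-#0⇒norms-#0 : ∀ u v → u ∧ v # 0# → u ∙ u * v ∙ v # 0#
  ∧-#0⇒norms-#0 u v u∧v#0 = pos⇒#0 (<-respʳ-≈ (sym (lagrange u v))
    (+-pos-nonneg (x#0⇒0<x² u∧v#0) (0≤x² (u ∙ v))))

  -- Tangent lines of a circle centred at the origin

  -- The line uv touches the circle with centre 0 and squared radius ρ at n.
  record Tangent (ρ : Carrier) (n u v : Point) : Set ℓ₁ where
    field
      n∙n : n ∙ n ≈ ρ
      n∙u : n ∙ u ≈ ρ
      n∙v : n ∙ v ≈ ρ

  open Tangent

  tangent-sym : ∀ {ρ n u v} → Tangent ρ n u v → Tangent ρ n v u
  tangent-sym τ = record { n∙n = n∙n τ ; n∙u = n∙v τ ; n∙v = n∙u τ }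

  -- A line meets a circle in a set symmetric about the foot of the
  -- perpendicular from the centre, so a unique common point is that foot.
  tangentAt⇒tangent : ∀ {O r P Q X} → (Q ⊖ P) ∙ (Q ⊖ P) # 0# → TangentAt O r P Q X →
    ∃[ n ] Tangent (value r * value r) n (P ⊖ O) (Q ⊖ O)
  tangentAt⇒tangent {O@(o₁ , o₂)} {r} {P@(p₁ , p₂)} {Q@(q₁ , q₂)} {X@(x₁ , x₂)} d²#0 tangent = n , record
    { n∙n = n∙n≈ρ
    -- Both endpoints differ from the contact point by multiples of `d`, which is orthogonal to `n`.
    ; n∙u = linear
        (solve 8 (λ o₁ o₂ p₁ p₂ q₁ q₂ t ρ →
          let o = o₁ , o₂; p = p₁ , p₂; q = q₁ , q₂; n = rayₚ p (q ⊖ₚ p) t ⊖ₚ o in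
          n ∙ₚ (p ⊖ₚ o) :- ρ := con (+ 1) :* (n ∙ₚ n :- ρ) :+ :- t :* (n ∙ₚ (q ⊖ₚ p) :- con (+ 0)))
          refl o₁ o₂ p₁ p₂ q₁ q₂ t ρ)
        (_ ⊛ n∙n≈ρ ⊕ _ ⊛ n∙d≈0)
    ; n∙v = linear
        (solve 8 (λ o₁ o₂ p₁ p₂ q₁ q₂ t ρ →
          let o = o₁ , o₂; p = p₁ , p₂; q = q₁ , q₂; n = rayₚ p (q ⊖ₚ p) t ⊖ₚ o in
          n ∙ₚ (q ⊖ₚ o) :- ρ :=
          con (+ 1) :* (n ∙ₚ n :- ρ) :+ (con (+ 1) :- t) :* (n ∙ₚ (q ⊖ₚ p) :- con (+ 0)))
          refl o₁ o₂ p₁ p₂ q₁ q₂ t ρ)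
        (_ ⊛ n∙n≈ρ ⊕ _ ⊛ n∙d≈0)
    }
    where
    ρ i t : Carrier
    ρ = value r * value r
    i = proj₁ (#⇒inverse d²#0)
    t = proj₁ (TangentAt.onLine tangent)

    x₁≈z₁ : x₁ ≈ p₁ + t * (q₁ - p₁)
    x₁≈z₁ = proj₁ (proj₂ (TangentAt.onLine tangent))

    x₂≈z₂ : x₂ ≈ p₂ + t * (q₂ - p₂)
    x₂≈z₂ = proj₂ (proj₂ (TangentAt.onLine tangent))

    -- The right side is `1 · 1#` because this is what `con (+ 1)` denotes.
    id²≈1 : i * ((Q ⊖ P) ∙ (Q ⊖ P)) ≈ 1 · 1#
    id²≈1 = trans (proj₂ (#⇒inverse d²#0)) (sym (+-identityʳ 1#))

    Z Y d n : Point
    Z = along P Q t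
    d = Q ⊖ P
    n = Z ⊖ O

    k t′ : Carrier
    k = n ∙ d
    -- The foot of the perpendicular has parameter `t - k * i`; doubling the step gives the
    -- reflection of `Z` in it.
    t′ = t - 2 · 1# * k * i
    Y = along P Q t′

    n∙n≈ρ : n ∙ n ≈ ρ
    n∙n≈ρ = begin
      n ∙ n      ≈⟨ solve 4 (λ o₁ o₂ z₁ z₂ → let o = o₁ , o₂; z = z₁ , z₂ in
                      (z ⊖ₚ o) ∙ₚ (z ⊖ₚ o) := (o ⊖ₚ z) ∙ₚ (o ⊖ₚ z)) refl o₁ o₂ (proj₁ Z) (proj₂ Z) ⟩
      dist² O Z  ≈⟨ +-cong (*-cong e₁ e₁) (*-cong e₂ e₂) ⟨
      dist² O X  ≈⟨ TangentAt.onCircle tangent ⟩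
      ρ          ∎
      where
      e₁ : o₁ - x₁ ≈ o₁ - proj₁ Z
      e₁ = +-congˡ (-‿cong x₁≈z₁)
      e₂ : o₂ - x₂ ≈ o₂ - proj₂ Z
      e₂ = +-congˡ (-‿cong x₂≈z₂)

    Y-onCircle : OnCircle O r Y
    Y-onCircle = linear
      (solve 10 (λ o₁ o₂ p₁ p₂ d₁ d₂ t k i ρ →
        let o = o₁ , o₂; p = p₁ , p₂; d = d₁ , d₂
            n = rayₚ p d t ⊖ₚ o
            y = rayₚ p d (t :- con (+ 2) :* k :* i) in
        (o ⊖ₚ y) ∙ₚ (o ⊖ₚ y) :- ρ :=
        con (+ 1) :* (n ∙ₚ n :- ρ)
          :+ (con (+ 4) :* i :* k) :* (k :- n ∙ₚ d)
          :+ (con (+ 4) :* k :* k :* i) :* (i :* (d ∙ₚ d) :- con (+ 1)))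
        refl o₁ o₂ p₁ p₂ (q₁ - p₁) (q₂ - p₂) t k i ρ)
      (_ ⊛ n∙n≈ρ ⊕ _ ⊛ refl {k} ⊕ _ ⊛ id²≈1)

    -- Uniqueness makes the reflected point coincide with `Z`, so the step `2 k i d` vanishes; its
    -- dot product with `d` is `2 k`.
    n∙d≈0 : n ∙ d ≈ 0#
    n∙d≈0 =
      let y₁≈x₁ , y₂≈x₂ = TangentAt.unique tangent Y Y-onCircle (t′ , refl , refl) in
      *-cancel-0 (pos⇒#0 (0<suc 1)) (linear
        (solve 7 (λ p₁ p₂ d₁ d₂ t k i →
          let p = p₁ , p₂; d = d₁ , d₂
              z = rayₚ p d t
              y = rayₚ p d (t :- con (+ 2) :* k :* i) in
          con (+ 2) :* k :- con (+ 0) :=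
          :- d₁ :* (proj₁ y :- proj₁ z) :+ :- d₂ :* (proj₂ y :- proj₂ z)
            :+ (:- con (+ 2) :* k) :* (i :* (d ∙ₚ d) :- con (+ 1)))
          refl p₁ p₂ (q₁ - p₁) (q₂ - p₂) t k i)
        (_ ⊛ trans y₁≈x₁ x₁≈z₁ ⊕ _ ⊛ trans y₂≈x₂ x₂≈z₂ ⊕ _ ⊛ id²≈1))

  norm-#0 : ∀ u v → u ∙ v # 0# → v ∙ v # 0#
  norm-#0 u v u∙v#0 = *-#0ʳ (pos⇒#0 (<-respʳ-≈ (trans (+-comm _ _) (sym (lagrange u v)))
    (+-pos-nonneg (x#0⇒0<x² u∙v#0) (0≤x² (u ∧ v)))))

  -- In the frame of `n`, `(n ∙ n) (u ∧ v) = (n ∙ u) (n ∧ v) - (n ∧ u) (n ∙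
  -- v)`; here all dot products equal `ρ`, which cancels.
  tangent-∧ : ∀ {ρ n u v} → ρ # 0# → Tangent ρ n u v → u ∧ v ≈ n ∧ v - n ∧ u
  tangent-∧ {ρ} {n₁ , n₂} {u₁ , u₂} {v₁ , v₂} ρ#0 τ = x-y≈0⇒x≈y (*-cancel-0 ρ#0 (linear
    (solve 7 (λ ρ n₁ n₂ u₁ u₂ v₁ v₂ → let n = n₁ , n₂; u = u₁ , u₂; v = v₁ , v₂ in
      ρ :* (u ∧ₚ v :- (n ∧ₚ v :- n ∧ₚ u)) :- con (+ 0) :=
      :- (u ∧ₚ v) :* (n ∙ₚ n :- ρ) :+ n ∧ₚ v :* (n ∙ₚ u :- ρ) :+ :- (n ∧ₚ u) :* (n ∙ₚ v :- ρ))
      refl ρ n₁ n₂ u₁ u₂ v₁ v₂)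
    (_ ⊛ n∙n τ ⊕ _ ⊛ n∙u τ ⊕ _ ⊛ n∙v τ)))

  -- Lagrange's identity for `n` and `u - v`, which are orthogonal.
  tangent-dist² : ∀ {ρ n u v} → Tangent ρ n u v →
    ρ * dist² u v ≈ (n ∧ v - n ∧ u) * (n ∧ v - n ∧ u)
  tangent-dist² {ρ} {n₁ , n₂} {u₁ , u₂} {v₁ , v₂} τ = linear
    (solve 7 (λ ρ n₁ n₂ u₁ u₂ v₁ v₂ →
      let n = n₁ , n₂; u = u₁ , u₂; v = v₁ , v₂; w = u ⊖ₚ v; x = n ∧ₚ v :- n ∧ₚ u in
      ρ :* w ∙ₚ w :- x :* x :=
      :- (w ∙ₚ w) :* (n ∙ₚ n :- ρ) :+ n ∙ₚ w :* (n ∙ₚ u :- ρ) :+ :- (n ∙ₚ w) :* (n ∙ₚ v :- ρ))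
      refl ρ n₁ n₂ u₁ u₂ v₁ v₂)
    (_ ⊛ n∙n τ ⊕ _ ⊛ n∙u τ ⊕ _ ⊛ n∙v τ)

  -- The two tangent segments from b have the same length, so the sum or the
  -- difference of n ∧ b and m ∧ b vanishes; were it the difference, n and m
  -- would coincide and a, b, c would be collinear.
  opposite-tangents : ∀ {ρ n m a b c} → ρ # 0# → det b c a # 0# →
    Tangent ρ n b c → Tangent ρ m b a → m ∧ b + n ∧ b ≈ 0#
  opposite-tangents {ρ} {n@(n₁ , n₂)} {m@(m₁ , m₂)} {a@(a₁ , a₂)} {b@(b₁ , b₂)} {c@(c₁ , c₂)} ρ#0 D#0 τ σ =
    -- A vanishing product does not constructively yield a vanishing factor. Instead `s` is
    -- multiplied by nonzero `ρ`, `β` and `D`, and the three equations turn `s β ρ D` into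
    -- `s β x z`, then `s δ y z`, then zero.
    *-cancel-0 (x#0y#0→xy#0 (x#0y#0→xy#0 ρ#0 b∙b#0) D#0) (linear
      (solve 8 (λ ρ β D s δ x y z →
        ρ :* β :* D :* s :- con (+ 0) :=
        s :* β :* (ρ :* D :- x :* z) :+ s :* z :* (β :* x :- δ :* y) :+ y :* z :* (s :* δ :- con (+ 0)))
        refl ρ (b ∙ b) (det b c a) (m ∧ b + n ∧ b) (n ∧ b - m ∧ b) (n ∙ (a ⊖ b)) (a ∧ b) (n ∧ (b ⊖ c)))
      (_ ⊛ ρD ⊕ _ ⊛ βx ⊕ _ ⊛ sδ))
    where
    b∙b#0 : b ∙ b # 0#
    b∙b#0 = norm-#0 n b (#-congʳ (sym (n∙u τ)) ρ#0)

    -- By Lagrange's identity, `n ∧ b` and `m ∧ b` both have square `ρ (b ∙ b) - ρ²`.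
    sδ : (m ∧ b + n ∧ b) * (n ∧ b - m ∧ b) ≈ 0 · 1#
    sδ = linear
      (solve 7 (λ ρ n₁ n₂ m₁ m₂ b₁ b₂ → let n = n₁ , n₂; m = m₁ , m₂; b = b₁ , b₂ in
        (m ∧ₚ b :+ n ∧ₚ b) :* (n ∧ₚ b :- m ∧ₚ b) :- con (+ 0) :=
        b ∙ₚ b :* (n ∙ₚ n :- ρ) :+ :- (b ∙ₚ b) :* (m ∙ₚ m :- ρ)
          :+ :- (n ∙ₚ b :+ ρ) :* (n ∙ₚ b :- ρ) :+ (m ∙ₚ b :+ ρ) :* (m ∙ₚ b :- ρ))
        refl ρ n₁ n₂ m₁ m₂ b₁ b₂)
      (_ ⊛ n∙n τ ⊕ _ ⊛ n∙n σ ⊕ _ ⊛ n∙u τ ⊕ _ ⊛ n∙u σ)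

    -- Expand `n ∙ a` and `m ∙ a` in the frame of `b` and subtract.
    βx : b ∙ b * n ∙ (a ⊖ b) ≈ (n ∧ b - m ∧ b) * a ∧ b
    βx = linear
      (solve 9 (λ ρ n₁ n₂ m₁ m₂ a₁ a₂ b₁ b₂ →
        let n = n₁ , n₂; m = m₁ , m₂; a = a₁ , a₂; b = b₁ , b₂ in
        b ∙ₚ b :* n ∙ₚ (a ⊖ₚ b) :- (n ∧ₚ b :- m ∧ₚ b) :* a ∧ₚ b :=
        b ∙ₚ b :* (m ∙ₚ a :- ρ) :+ (a ∙ₚ b :- b ∙ₚ b) :* (n ∙ₚ b :- ρ)
          :+ :- (a ∙ₚ b) :* (m ∙ₚ b :- ρ))
        refl ρ n₁ n₂ m₁ m₂ a₁ a₂ b₁ b₂)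
      (_ ⊛ n∙v σ ⊕ _ ⊛ n∙u τ ⊕ _ ⊛ n∙u σ)

    ρD : ρ * det b c a ≈ n ∙ (a ⊖ b) * n ∧ (b ⊖ c)
    ρD = linear
      (solve 9 (λ ρ n₁ n₂ a₁ a₂ b₁ b₂ c₁ c₂ →
        let n = n₁ , n₂; a = a₁ , a₂; b = b₁ , b₂; c = c₁ , c₂
            D = (c ⊖ₚ b) ∧ₚ (a ⊖ₚ b) in
        ρ :* D :- n ∙ₚ (a ⊖ₚ b) :* n ∧ₚ (b ⊖ₚ c) :=
        :- D :* (n ∙ₚ n :- ρ) :+ n ∧ₚ (a ⊖ₚ b) :* (n ∙ₚ c :- ρ)
          :+ :- (n ∧ₚ (a ⊖ₚ b)) :* (n ∙ₚ b :- ρ))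
        refl ρ n₁ n₂ a₁ a₂ b₁ b₂ c₁ c₂)
      (_ ⊛ n∙n τ ⊕ _ ⊛ n∙v τ ⊕ _ ⊛ n∙u τ)

  -- Determinants, Heron's formula and the circumradius

  det-cycle : ∀ a b c → det b c a ≈ det a b c
  det-cycle (a₁ , a₂) (b₁ , b₂) (c₁ , c₂) = solve 6 (λ a₁ a₂ b₁ b₂ c₁ c₂ →
    let a = a₁ , a₂; b = b₁ , b₂; c = c₁ , c₂ in
    (c ⊖ₚ b) ∧ₚ (a ⊖ₚ b) := (b ⊖ₚ a) ∧ₚ (c ⊖ₚ a)) refl a₁ a₂ b₁ b₂ c₁ c₂

  det-∧ : ∀ a b c → det a b c ≈ a ∧ b + b ∧ c + c ∧ a
  det-∧ (a₁ , a₂) (b₁ , b₂) (c₁ , c₂) = solve 6 (λ a₁ a₂ b₁ b₂ c₁ c₂ →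
    let a = a₁ , a₂; b = b₁ , b₂; c = c₁ , c₂ in
    (b ⊖ₚ a) ∧ₚ (c ⊖ₚ a) := a ∧ₚ b :+ b ∧ₚ c :+ c ∧ₚ a) refl a₁ a₂ b₁ b₂ c₁ c₂

  det-translate : ∀ o a b c → det (a ⊖ o) (b ⊖ o) (c ⊖ o) ≈ det a b c
  det-translate (o₁ , o₂) (a₁ , a₂) (b₁ , b₂) (c₁ , c₂) = solve 8 (λ o₁ o₂ a₁ a₂ b₁ b₂ c₁ c₂ →
    let o = o₁ , o₂; a = a₁ , a₂; b = b₁ , b₂; c = c₁ , c₂ in
    (b ⊖ₚ o ⊖ₚ (a ⊖ₚ o)) ∧ₚ (c ⊖ₚ o ⊖ₚ (a ⊖ₚ o)) := (b ⊖ₚ a) ∧ₚ (c ⊖ₚ a))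
    refl o₁ o₂ a₁ a₂ b₁ b₂ c₁ c₂

  dist²-translate : ∀ o p q → dist² (p ⊖ o) (q ⊖ o) ≈ dist² p q
  dist²-translate (o₁ , o₂) (p₁ , p₂) (q₁ , q₂) = solve 6 (λ o₁ o₂ p₁ p₂ q₁ q₂ →
    let o = o₁ , o₂; p = p₁ , p₂; q = q₁ , q₂; d = p ⊖ₚ o ⊖ₚ (q ⊖ₚ o) in
    d ∙ₚ d := (p ⊖ₚ q) ∙ₚ (p ⊖ₚ q))
    refl o₁ o₂ p₁ p₂ q₁ q₂

  -- Heron's polynomial in the squared side lengths.
  16Area² : Carrier → Carrier → Carrier → Carrier
  16Area² x y z = 4 · 1# * y * z - (y + z - x) * (y + z - x)

  16Area²-cong : ∀ {x x′ y y′ z z′} → x ≈ x′ → y ≈ y′ → z ≈ z′ → 16Area² x y z ≈ 16Area² x′ y′ z′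
  16Area²-cong x≈ y≈ z≈ = +-cong (*-cong (*-congˡ y≈) z≈) (-‿cong (*-cong e e))
    where e = +-cong (+-cong y≈ z≈) (-‿cong x≈)

  -- By the law of cosines the subtracted square is `(2 u ∙ v)²` for the edge vectors `u`, `v` from
  -- `a`; the rest is Lagrange's identity.
  heron : ∀ a b c →
    4 · 1# * (det a b c * det a b c) ≈ 16Area² (dist² b c) (dist² c a) (dist² a b)
  heron (a₁ , a₂) (b₁ , b₂) (c₁ , c₂) = solve 6 (λ a₁ a₂ b₁ b₂ c₁ c₂ →
    let a = a₁ , a₂; b = b₁ , b₂; c = c₁ , c₂
        D = (b ⊖ₚ a) ∧ₚ (c ⊖ₚ a)
        x = (b ⊖ₚ c) ∙ₚ (b ⊖ₚ c); y = (c ⊖ₚ a) ∙ₚ (c ⊖ₚ a); z = (a ⊖ₚ b) ∙ₚ (a ⊖ₚ b) in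
    con (+ 4) :* (D :* D) := con (+ 4) :* y :* z :- (y :+ z :- x) :* (y :+ z :- x))
    refl a₁ a₂ b₁ b₂ c₁ c₂

  -- The square of `4 R Δ = |BC| |CA| |AB|`. Equal distances give `2 w ∙ u = u ∙ u` and
  -- `2 w ∙ v = v ∙ v`, and `D² |w|²` is the squared norm of `(w ∙ u) v - (w ∙ v) u`.
  circumradius² : ∀ {R² a b c p} → dist² p a ≈ R² → dist² p b ≈ R² → dist² p c ≈ R² →
    4 · 1# * R² * (det a b c * det a b c) ≈ dist² b c * dist² c a * dist² a b
  circumradius² {R²} {a₁ , a₂} {b₁ , b₂} {c₁ , c₂} {p₁ , p₂} pa pb pc = linear
    (solve 9 (λ R² a₁ a₂ b₁ b₂ c₁ c₂ p₁ p₂ →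
      let a = a₁ , a₂; b = b₁ , b₂; c = c₁ , c₂; p = p₁ , p₂
          u = b ⊖ₚ a; v = c ⊖ₚ a; w = p ⊖ₚ a; D = u ∧ₚ v
          x = con (+ 2) :* w ∙ₚ u; y = con (+ 2) :* w ∙ₚ v
          -- `f` and `g` are the cofactors of `x - u ∙ u` and `y - v ∙ v` when these values are
          -- substituted in `|x v - y u|²`.
          f = (x :+ u ∙ₚ u) :* v ∙ₚ v :- con (+ 2) :* y :* u ∙ₚ v
          g = (y :+ v ∙ₚ v) :* u ∙ₚ u :- con (+ 2) :* u ∙ₚ u :* u ∙ₚ v in
      con (+ 4) :* R² :* (D :* D)
        :- (b ⊖ₚ c) ∙ₚ (b ⊖ₚ c) :* (c ⊖ₚ a) ∙ₚ (c ⊖ₚ a) :* (a ⊖ₚ b) ∙ₚ (a ⊖ₚ b) :=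
      (f :+ g :- con (+ 4) :* (D :* D)) :* (w ∙ₚ w :- R²)
        :+ :- f :* ((p ⊖ₚ b) ∙ₚ (p ⊖ₚ b) :- R²) :+ :- g :* ((p ⊖ₚ c) ∙ₚ (p ⊖ₚ c) :- R²))
      refl R² a₁ a₂ b₁ b₂ c₁ c₂ p₁ p₂)
    (_ ⊛ pa ⊕ _ ⊛ pb ⊕ _ ⊛ pc)

  -- From three tangents to `r² < 16 R²`

  exradius²-bound : ∀ {ρ R² D x y z p q t} → 0# < ρ → D # 0# →
    ρ * x ≈ (p + q) * (p + q) → ρ * y ≈ (q + t) * (q + t) → ρ * z ≈ (t + p) * (t + p) →
    D ≈ 2 · 1# * (p + q + t) → 4 · 1# * (D * D) ≈ 16Area² x y z →
    4 · 1# * R² * (D * D) ≈ x * y * z →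
    ρ < 16 · 1# * R²
  exradius²-bound {ρ} {R²} {D} {x} {y} {z} {p} {q} {t} 0<ρ D#0 ρx ρy ρz D≈2e₁ area circum =
    -- Multiplied by `ρ⁵`, the difference becomes a sum of visibly positive terms.
    0<y-x⇒x<y (*-cancelʳ-pos (*-pos 0<ρ² (*-pos 0<ρ² 0<ρ)) (<-respʳ-≈ (sym gap) 0<gap))
    where
    e₁ e₂ e₃ gap-value : Carrier
    e₁ = p + q + t
    e₂ = p * q + q * t + t * p
    e₃ = p * (q * t)

    0<ρ² : 0# < ρ * ρ
    0<ρ² = *-pos 0<ρ 0<ρ

    e₁#0 : e₁ # 0#
    e₁#0 = *-#0ʳ (#-congʳ D≈2e₁ D#0)

    -- For sides `p + q`, `q + t`, `t + p` the half perimeter is `e₁` and Heron's polynomial is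
    -- `16 e₁ e₃`. It is homogeneous of degree two, whence the factor `ρ²`.
    e₃≈ρ²e₁ : e₃ ≈ ρ * ρ * e₁
    e₃≈ρ²e₁ = x-y≈0⇒x≈y (*-cancel-0 (x#0y#0→xy#0 (pos⇒#0 (0<suc 15)) e₁#0) (begin
      16 · 1# * e₁ * (e₃ - ρ * ρ * e₁)
        ≈⟨ solve 4 (λ ρ p q t →
             let e₁ = p :+ q :+ t; e₃ = p :* (q :* t)
                 x = (p :+ q) :* (p :+ q); y = (q :+ t) :* (q :+ t); z = (t :+ p) :* (t :+ p) in
             con (+ 16) :* e₁ :* (e₃ :- ρ :* ρ :* e₁) :=
             con (+ 4) :* y :* z :- (y :+ z :- x) :* (y :+ z :- x)
               :- ρ :* ρ :* (con (+ 4) :* ((con (+ 2) :* e₁) :* (con (+ 2) :* e₁)))) refl ρ p q t ⟩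
      16Area² ((p + q) * (p + q)) ((q + t) * (q + t)) ((t + p) * (t + p))
        - ρ * ρ * (4 · 1# * (2 · 1# * e₁ * (2 · 1# * e₁)))
        ≈⟨ +-cong (16Area²-cong ρx ρy ρz) (-‿cong (*-congˡ (*-congˡ (*-cong D≈2e₁ D≈2e₁)))) ⟨
      16Area² (ρ * x) (ρ * y) (ρ * z) - ρ * ρ * (4 · 1# * (D * D))
        ≈⟨ solve 5 (λ ρ x y z w →
             con (+ 4) :* (ρ :* y) :* (ρ :* z)
               :- (ρ :* y :+ ρ :* z :- ρ :* x) :* (ρ :* y :+ ρ :* z :- ρ :* x) :- ρ :* ρ :* w :=
             :- (ρ :* ρ) :* (w :- (con (+ 4) :* y :* z :- (y :+ z :- x) :* (y :+ z :- x))))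
             refl ρ x y z (4 · 1# * (D * D)) ⟩
      - (ρ * ρ) * (4 · 1# * (D * D) - 16Area² x y z)
        ≈⟨ _ ⊛ area ⟩
      0# ∎))

    -- Since `(p + q) (q + t) (t + p) = e₁ e₂ - e₃`, replacing `e₃` by `ρ² e₁` exposes a factor
    -- `e₁²` to cancel.
    circum′ : 16 · 1# * R² * (ρ * ρ * ρ) ≈ (e₂ - ρ * ρ) * (e₂ - ρ * ρ)
    circum′ = x-y≈0⇒x≈y (*-cancel-0 (x#0y#0→xy#0 e₁#0 e₁#0) (x-y≈0 (begin
      e₁ * e₁ * (16 · 1# * R² * (ρ * ρ * ρ))
        ≈⟨ solve 3 (λ ρ R² e₁ →
             e₁ :* e₁ :* (con (+ 16) :* R² :* (ρ :* ρ :* ρ)) :=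
             ρ :* ρ :* ρ :* (con (+ 4) :* R² :* (con (+ 2) :* e₁ :* (con (+ 2) :* e₁)))) refl ρ R² e₁ ⟩
      ρ * ρ * ρ * (4 · 1# * R² * (2 · 1# * e₁ * (2 · 1# * e₁)))
        ≈⟨ *-congˡ (*-congˡ (*-cong D≈2e₁ D≈2e₁)) ⟨
      ρ * ρ * ρ * (4 · 1# * R² * (D * D))
        ≈⟨ *-congˡ circum ⟩
      ρ * ρ * ρ * (x * y * z)
        ≈⟨ solve 4 (λ ρ x y z → ρ :* ρ :* ρ :* (x :* y :* z) := ρ :* x :* (ρ :* y) :* (ρ :* z))
             refl ρ x y z ⟩
      ρ * x * (ρ * y) * (ρ * z)
        ≈⟨ *-cong (*-cong ρx ρy) ρz ⟩
      (p + q) * (p + q) * ((q + t) * (q + t)) * ((t + p) * (t + p))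
        ≈⟨ solve 3 (λ p q t →
             let e₁ = p :+ q :+ t; e₂ = p :* q :+ q :* t :+ t :* p; e₃ = p :* (q :* t) in
             (p :+ q) :* (p :+ q) :* ((q :+ t) :* (q :+ t)) :* ((t :+ p) :* (t :+ p)) :=
             (e₁ :* e₂ :- e₃) :* (e₁ :* e₂ :- e₃)) refl p q t ⟩
      (e₁ * e₂ - e₃) * (e₁ * e₂ - e₃)
        ≈⟨ *-cong e₁e₂-e₃ e₁e₂-e₃ ⟩
      (e₁ * e₂ - ρ * ρ * e₁) * (e₁ * e₂ - ρ * ρ * e₁)
        ≈⟨ solve 3 (λ ρ e₁ e₂ →
             (e₁ :* e₂ :- ρ :* ρ :* e₁) :* (e₁ :* e₂ :- ρ :* ρ :* e₁) :=
             e₁ :* e₁ :* ((e₂ :- ρ :* ρ) :* (e₂ :- ρ :* ρ))) refl ρ e₁ e₂ ⟩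
      e₁ * e₁ * ((e₂ - ρ * ρ) * (e₂ - ρ * ρ)) ∎)))
      where
      e₁e₂-e₃ : e₁ * e₂ - e₃ ≈ e₁ * e₂ - ρ * ρ * e₁
      e₁e₂-e₃ = +-congˡ (-‿cong e₃≈ρ²e₁)

      x-y≈0 : ∀ {u v w} → u * v ≈ u * w → u * (v - w) ≈ 0#
      x-y≈0 {u} {v} {w} uv≈uw =
        trans (solve 3 (λ u v w → u :* (v :- w) := u :* v :- u :* w) refl u v w) (x≈y⇒x-y≈0 uv≈uw)

    gap-value = p * p * (ρ * ρ + q * q) * (ρ * ρ + t * t)
      + ρ * ρ * (q * q * (ρ * ρ + t * t) + ρ * ρ * (t * t))

    -- With e₃ = ρ² e₁, taking norms in (ρ + i p)(ρ + i q)(ρ + i t) gives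
    -- (ρ² + p²)(ρ² + q²)(ρ² + t²) = ρ² (e₂ − ρ²)², whose left-hand side is
    -- ρ⁶ + gap-value.
    gap : (16 · 1# * R² - ρ) * (ρ * ρ * (ρ * ρ * ρ)) ≈ gap-value
    gap = linear
      (solve 5 (λ ρ R² p q t →
        let e₁ = p :+ q :+ t; e₂ = p :* q :+ q :* t :+ t :* p; e₃ = p :* (q :* t) in
        (con (+ 16) :* R² :- ρ) :* (ρ :* ρ :* (ρ :* ρ :* ρ))
          :- (p :* p :* (ρ :* ρ :+ q :* q) :* (ρ :* ρ :+ t :* t)
            :+ ρ :* ρ :* (q :* q :* (ρ :* ρ :+ t :* t) :+ ρ :* ρ :* (t :* t))) :=
        ρ :* ρ :* (con (+ 16) :* R² :* (ρ :* ρ :* ρ) :- (e₂ :- ρ :* ρ) :* (e₂ :- ρ :* ρ))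
          :+ :- (e₃ :- ρ :* ρ :* e₁) :* (e₃ :- ρ :* ρ :* e₁))
        refl ρ R² p q t)
      (_ ⊛ circum′ ⊕ _ ⊛ e₃≈ρ²e₁)

    -- Strictness comes from here: `p`, `q` and `t` are factors of `e₃`, so all three are apart from
    -- zero.
    e₃#0 : e₃ # 0#
    e₃#0 = #-congʳ (sym e₃≈ρ²e₁) (x#0y#0→xy#0 (pos⇒#0 0<ρ²) e₁#0)

    0<p² : 0# < p * p
    0<p² = x#0⇒0<x² (*-#0ˡ e₃#0)

    0<q² : 0# < q * q
    0<q² = x#0⇒0<x² (*-#0ˡ (*-#0ʳ e₃#0))

    0<t² : 0# < t * t
    0<t² = x#0⇒0<x² (*-#0ʳ (*-#0ʳ e₃#0))

    0<gap : 0# < gap-value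
    0<gap = +-pos (*-pos (*-pos 0<p² (+-pos 0<ρ² 0<q²)) (+-pos 0<ρ² 0<t²))
      (*-pos 0<ρ² (+-pos (*-pos 0<q² (+-pos 0<ρ² 0<t²)) (*-pos 0<ρ² 0<t²)))

  tangents⇒bound : ∀ {ρ R² a b c m n₁ n₂ n₃} → 0# < ρ → det a b c # 0# →
    Tangent ρ n₁ b c → Tangent ρ n₂ c a → Tangent ρ n₃ a b →
    dist² m a ≈ R² → dist² m b ≈ R² → dist² m c ≈ R² →
    ρ < 16 · 1# * R²
  tangents⇒bound {ρ} {R²} {a} {b} {c} {m} {n₁} {n₂} {n₃} 0<ρ D#0 τ₁ τ₂ τ₃ ma mb mc =
    exradius²-bound {p = n₃ ∧ b} {n₁ ∧ c} {n₂ ∧ a} 0<ρ D#0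
      (side τ₁ at-b) (side τ₂ at-c) (side τ₃ at-a) perimeter (heron a b c) (circumradius² ma mb mc)
    where
    ρ#0 : ρ # 0#
    ρ#0 = pos⇒#0 0<ρ

    D′#0 : det b c a # 0#
    D′#0 = #-congʳ (sym (det-cycle a b c)) D#0

    -- `opposite-tangents` takes both lines as starting at the common vertex, so one of them is
    -- reversed.
    at-b : n₃ ∧ b + n₁ ∧ b ≈ 0#
    at-b = opposite-tangents ρ#0 D′#0 τ₁ (tangent-sym τ₃)

    at-c : n₁ ∧ c + n₂ ∧ c ≈ 0#
    at-c = opposite-tangents ρ#0 (#-congʳ (sym (det-cycle b c a)) D′#0) τ₂ (tangent-sym τ₁)

    at-a : n₂ ∧ a + n₃ ∧ a ≈ 0#
    at-a = opposite-tangents ρ#0 D#0 τ₃ (tangent-sym τ₂)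

    -- Trades the cross product at the first endpoint for the one from the adjacent side, so that
    -- differences along a side become sums.
    flip : ∀ {x y z} → x + y ≈ 0# → z - y ≈ x + z
    flip {x} {y} {z} x+y≈0 = linear
      (solve 3 (λ x y z → z :- y :- (x :+ z) := :- con (+ 1) :* (x :+ y :- con (+ 0))) refl x y z)
      (_ ⊛ x+y≈0)

    side : ∀ {n u v x} → Tangent ρ n u v → x + n ∧ u ≈ 0# →
      ρ * dist² u v ≈ (x + n ∧ v) * (x + n ∧ v)
    side τ x+n∧u≈0 = trans (tangent-dist² τ) (*-cong (flip x+n∧u≈0) (flip x+n∧u≈0))

    edge : ∀ {n u v x} → Tangent ρ n u v → x + n ∧ u ≈ 0# → u ∧ v ≈ x + n ∧ v
    edge τ x+n∧u≈0 = trans (tangent-∧ ρ#0 τ) (flip x+n∧u≈0)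

    perimeter : det a b c ≈ 2 · 1# * (n₃ ∧ b + n₁ ∧ c + n₂ ∧ a)
    perimeter = begin
      det a b c
        ≈⟨ det-∧ a b c ⟩
      a ∧ b + b ∧ c + c ∧ a
        ≈⟨ +-cong (+-cong (edge τ₃ at-a) (edge τ₁ at-b)) (edge τ₂ at-c) ⟩
      (n₂ ∧ a + n₃ ∧ b) + (n₃ ∧ b + n₁ ∧ c) + (n₁ ∧ c + n₂ ∧ a)
        ≈⟨ solve 3 (λ p q t → t :+ p :+ (p :+ q) :+ (q :+ t) := con (+ 2) :* (p :+ q :+ t))
             refl (n₃ ∧ b) (n₁ ∧ c) (n₂ ∧ a) ⟩
      2 · 1# * (n₃ ∧ b + n₁ ∧ c + n₂ ∧ a) ∎

  -- Translation by `O` centres the excircle at the origin; nondegeneracy supplies the nonzero side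
  -- lengths required to extract the contact points.
  excircle⇒bound : ∀ {A B C O} {R r : ℝ⁺} M → det A B C # 0# →
    OnCircle M R A → OnCircle M R B → OnCircle M R C → IsExcircleOpposite A B C O r →
    value r * value r < 16 · 1# * (value R * value R)
  excircle⇒bound {A} {B} {C} {O} {R} {r} M D#0 MA MB MC excircle =
    tangents⇒bound {m = M ⊖ O} (*-pos (positive r) (positive r))
      (#-congʳ (sym (det-translate O A B C)) D#0)
      (proj₂ (tangentAt⇒tangent {r = r} BC#0 (proj₂ (proj₂ touches-BC))))
      (tangent-sym (proj₂ (tangentAt⇒tangent {r = r} (*-#0ʳ AB*AC#0) (proj₂ (proj₂ touches-AC)))))
      (proj₂ (tangentAt⇒tangent {r = r} (*-#0ˡ AB*AC#0) (proj₂ (proj₂ touches-AB))))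
      (trans (dist²-translate O M A) MA)
      (trans (dist²-translate O M B) MB)
      (trans (dist²-translate O M C) MC)
    where
    open IsExcircleOpposite excircle

    AB*AC#0 : (B ⊖ A) ∙ (B ⊖ A) * (C ⊖ A) ∙ (C ⊖ A) # 0#
    AB*AC#0 = ∧-#0⇒norms-#0 (B ⊖ A) (C ⊖ A) D#0

    BC#0 : (C ⊖ B) ∙ (C ⊖ B) # 0#
    BC#0 = *-#0ˡ (∧-#0⇒norms-#0 (C ⊖ B) (A ⊖ B) (#-congʳ (sym (det-cycle A B C)) D#0))

  -- From squares to the ratio `R / r`

  /-* : ∀ x y → x / y * value y ≈ x
  /-* x (y ,⁺ 0<y) = let i , iy≈1 , _ = #⇒invertible (pos⇒#0 0<y) in begin
    x * i * y           ≈⟨ solve 3 (λ x i y → x :* i :* y := x :* (i :* (y :- con (+ 0)))) refl x i y ⟩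
    x * (i * (y - 0#))  ≈⟨ *-congˡ iy≈1 ⟩
    x * 1#              ≈⟨ *-identityʳ x ⟩
    x                   ∎

  -- The factor `4 R + r` of `16 R² - r²` is positive, so `4 R - r` is too; this is the wanted
  -- difference times `4 r`.
  ratio-bound : ∀ (R r : ℝ⁺) → value r * value r < 16 · 1# * (value R * value R) →
    1/4 < value R / r
  ratio-bound R⁺@(R ,⁺ 0<R) r⁺@(r ,⁺ 0<r) r²<16R² =
    0<y-x⇒x<y (*-cancelʳ-pos (*-pos (0<suc 3) 0<r) (<-respʳ-≈ (sym clear) 0<4R-r))
    where
    0<4R-r : 0# < 4 · 1# * R - r
    0<4R-r = *-cancelʳ-pos (+-pos (*-pos (0<suc 3) 0<R) 0<r)
      (<-respʳ-≈ (solve 2 (λ R r →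
          con (+ 16) :* (R :* R) :- r :* r := (con (+ 4) :* R :- r) :* (con (+ 4) :* R :+ r)) refl R r)
        (x<y⇒0<y-x r²<16R²))

    clear : (R / r⁺ - 1/4) * (4 · 1# * r) ≈ 4 · 1# * R - r
    clear = linear
      (solve 4 (λ R r x y →
        (x :- y) :* (con (+ 4) :* r) :- (con (+ 4) :* R :- r) :=
        con (+ 4) :* (x :* r :- R) :+ :- r :* (y :* con (+ 4) :- con (+ 1))) refl R r (R / r⁺) 1/4)
      (_ ⊛ /-* R r⁺ ⊕ _ ⊛ trans (/-* 1# (4 · 1# ,⁺ 0<suc 3)) (sym (+-identityʳ 1#)))

lemma1 : ∀ {c ℓ₁ ℓ₂} (ℝ : Reals c ℓ₁ ℓ₂) →
    let open Reals ℝ in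
    let open EuclideanPlane ℝ in
    (T : Triangle) (R r : ℝ⁺) →
    IsCircumradius T R → IsExradius T r →
    1/4 < value R / r
lemma1 ℝ T R r (M , MA , MB , MC) (_ , excircle) = ratio-bound R r (bound excircle)
  where
  open Reals ℝ
  open EuclideanPlane ℝ
  open EuclideanPlane.Triangle T
  open Plane ℝ
  open HeytingProperties heytingCommutativeRing using (#-congʳ)

  D′#0 : det B C A # 0#
  D′#0 = #-congʳ (sym (det-cycle A B C)) nondegenerate

  bound : ∀ {O} → IsExcircleOpposite A B C O r ⊎ IsExcircleOpposite B C A O r ⊎
    IsExcircleOpposite C A B O r → value r * value r < 16 · 1# * (value R * value R)
  -- The other excircles reduce to the first case by cyclic relabelling of the vertices.
  bound (inj₁ ex)        = excircle⇒bound {R = R} {r} M nondegenerate MA MB MC ex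
  bound (inj₂ (inj₁ ex)) = excircle⇒bound {R = R} {r} M D′#0 MB MC MA ex
  bound (inj₂ (inj₂ ex)) =
    excircle⇒bound {R = R} {r} M (#-congʳ (sym (det-cycle B C A)) D′#0) MC MA MB ex
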